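{- For any integers $n\geq 2$ and $p\geq 3$, the Sierpiński graph $S_p^n$ satisfies $$\gamma_{oitR}(S_p^n)=p\left\lceil\frac{p^{n-1}}{2}\right\rceil+(p-1)\left\lfloor\frac{p^{n-1}}{2}\right\rfloor.$$
   Context: For integers $n\geq 2$ and $p\geq 3$, the Sierpiński graph $S_p^n$ is the simple graph on the vertex set $\{0, 1,\ldots, p-1\}^n$, where two different vertices $(i_1,\ldots, i_n)$ and $(j_1, \ldots, j_n)$ are adjacent if and only if there exists an index $r\in\{1, \ldots, n\}$ such that (i) $i_t = j_t$ for $t=1,\ldots,r-1$; (ii) $i_r \neq j_r$; and (iii) $i_t = j_r$ and $j_t = i_r$ for $t=r+1,\ldots,n$. For a graph $G$ with no isolated vertex and a function $f:V(G)\to\{0,1,2\}$, let $V_i=\{v\in V(G): f(v)=i\}$ for $i\in\{0,1,2\}$. The function $f$ is an outer-independent total Roman dominating function on $G$ if (i) every vertex in $V_0$ is adjacent to at least one vertex in $V_2$; (ii) $V_0$ is an independent set; and (iii) the subgraph induced by $V_1\cup V_2$ has no isolated vertex. The outer-independent total Roman domination number $\gamma_{oitR}(G)$ is the minimum weight $\omega(f)=\sum_{v\in V(G)}f(v)$ among all such functions. -}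

module Defs where

open import Algebra.Properties.CommutativeMonoid.Sum as Sum using ()
open import Data.Fin.Base using (Fin; zero; suc; toℕ; fromℕ; _<_; funToFin; finToFun)
open import Data.Fin.Patterns using (0F; 1F; 2F)
open import Data.Fin.Properties using (≤fromℕ; funToFin-finToFin; finToFun-funToFin)
open import Data.Nat.Base as ℕ using (ℕ; z≤n; s≤s)
open import Data.Nat.Properties using (+-0-commutativeMonoid; <⇒≱)
open import Data.Product.Base using (Σ; ∃; _×_; _,_; proj₁; proj₂)
open import Data.Sum.Base using (_⊎_)
open import Data.Vec.Base using (Vec; lookup; tabulate; _[_]≔_)
open import Data.Vec.Properties
  using (lookup∘tabulate; tabulate∘lookup; tabulate-cong; lookup∘update; lookup∘update′)
open import Function.Base using (_on_; _∘_)
open import Function.Bundles using (_↔_; mk↔ₛ′; Inverse)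
open import Relation.Binary.Core using (Rel)
open import Relation.Binary.Definitions using (Irreflexive; Symmetric)
open import Relation.Binary.PropositionalEquality
  using (_≡_; _≢_; refl; sym; trans)
open import Relation.Nullary.Negation using (¬_; contradiction)
open import Relation.Unary using (Pred)
open import Level using (0ℓ)

open Sum +-0-commutativeMonoid using (sum)

record FiniteGraph : Set₁ where
  field
    Vertex      : Set
    order       : ℕ
    enumeration : Fin order ↔ Vertex
    Adjacent    : Rel Vertex 0ℓ
    irreflexive : Irreflexive _≡_ Adjacent
    symmetric   : Symmetric Adjacent

NoIsolatedVertex : {V : Set} → Rel V 0ℓ → Set
NoIsolatedVertex {V} _~_ = ∀ (u : V) → ∃ λ v → u ~ v

Independent : {V : Set} → Rel V 0ℓ → Pred V 0ℓ → Set
Independent _~_ P = ∀ u v → P u → P v → ¬ (u ~ v)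

Induced : {V : Set} → Rel V 0ℓ → (P : Pred V 0ℓ) → Rel (Σ V P) 0ℓ
Induced _~_ P = _~_ on proj₁

module OITRD (G : FiniteGraph)
             (noIsolated : NoIsolatedVertex (FiniteGraph.Adjacent G)) where

  open FiniteGraph G

  V₀ V₁ V₂ : (Vertex → Fin 3) → Pred Vertex 0ℓ
  V₀ f v = f v ≡ 0F
  V₁ f v = f v ≡ 1F
  V₂ f v = f v ≡ 2F

  record IsOITRDFunction (f : Vertex → Fin 3) : Set where
    field
      dominating  : ∀ u → V₀ f u → ∃ λ v → Adjacent u v × V₂ f v
      independent : Independent Adjacent (V₀ f)
      total       : NoIsolatedVertex (Induced Adjacent (λ v → V₁ f v ⊎ V₂ f v))

  weight : (Vertex → Fin 3) → ℕ
  weight f = sum (λ i → toℕ (f (Inverse.to enumeration i)))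

  -- `IsOITRDNumber k` expresses γ_oitR(G) = k.
  record IsOITRDNumber (k : ℕ) : Set where
    field
      attained : ∃ λ f → IsOITRDFunction f × weight f ≡ k
      minimal  : ∀ f → IsOITRDFunction f → k ℕ.≤ weight f

open OITRD public using (IsOITRDNumber)

module _ {p n : ℕ} where

  -- Distinctness of u and v is implied by the second clause.
  SierpińskiAdjacent : Rel (Vec (Fin p) n) 0ℓ
  SierpińskiAdjacent u v = ∃ λ (r : Fin n) →
      (∀ t → t < r → lookup u t ≡ lookup v t)
    × lookup u r ≢ lookup v r
    × (∀ t → r < t → lookup u t ≡ lookup v r × lookup v t ≡ lookup u r)

  sierpińskiAdjacent-irreflexive : Irreflexive _≡_ SierpińskiAdjacent
  sierpińskiAdjacent-irreflexive refl (_ , _ , u≢u , _) = u≢u refl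

  sierpińskiAdjacent-symmetric : Symmetric SierpińskiAdjacent
  sierpińskiAdjacent-symmetric (r , before , at , after) =
    r , (λ t t<r → sym (before t t<r))
      , (λ eq → at (sym eq))
      , (λ t r<t → proj₂ (after t r<t) , proj₁ (after t r<t))

words : ∀ p n → Fin (p ℕ.^ n) ↔ Vec (Fin p) n
words p n = mk↔ₛ′ (tabulate ∘ finToFun) (funToFin ∘ lookup) left right
  where
  left : ∀ v → tabulate (finToFun (funToFin (lookup v))) ≡ v
  left v = trans (tabulate-cong (finToFun-funToFin (lookup v))) (tabulate∘lookup v)

  funToFin-cong : ∀ {m} {f g : Fin m → Fin p} → (∀ i → f i ≡ g i) → funToFin f ≡ funToFin g
  funToFin-cong {ℕ.zero}  _ = refl
  funToFin-cong {ℕ.suc m} f≗g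
    rewrite f≗g zero | funToFin-cong (λ i → f≗g (suc i)) = refl

  right : ∀ i → funToFin (lookup (tabulate (finToFun {p} {n} i))) ≡ i
  right i = trans (funToFin-cong (lookup∘tabulate (finToFun {p} {n} i)))
                  (funToFin-finToFin {n} {p} i)

Sierpiński : (p n : ℕ) → FiniteGraph
Sierpiński p n = record
  { Vertex      = Vec (Fin p) n
  ; order       = p ℕ.^ n
  ; enumeration = words p n
  ; Adjacent    = SierpińskiAdjacent
  ; irreflexive = λ {u} {v} → sierpińskiAdjacent-irreflexive {x = u} {y = v}
  ; symmetric   = λ {u} {v} → sierpińskiAdjacent-symmetric {x = u} {y = v}
  }

sierpiński-noIsolated : ∀ {p n} → 2 ℕ.≤ n → 3 ℕ.≤ p →
                        NoIsolatedVertex (FiniteGraph.Adjacent (Sierpiński p n))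
sierpiński-noIsolated {ℕ.suc (ℕ.suc q)} {ℕ.suc m} _ _ u =
  u [ last ]≔ other x , last , before , at , after
  where
  last = fromℕ m
  x    = lookup u last

  other : Fin (ℕ.suc (ℕ.suc q)) → Fin (ℕ.suc (ℕ.suc q))
  other zero    = 1F
  other (suc _) = 0F

  other-≢ : ∀ i → i ≢ other i
  other-≢ zero    ()
  other-≢ (suc _) ()

  before : ∀ t → t < last → lookup u t ≡ lookup (u [ last ]≔ other x) t
  before t t<last = sym (lookup∘update′ (λ { refl → <⇒≱ t<last (≤fromℕ t) }) u (other x))

  at : x ≢ lookup (u [ last ]≔ other x) last
  at eq = other-≢ x (trans eq (lookup∘update last u (other x)))

  after : ∀ t → last < t → lookup u t ≡ lookup (u [ last ]≔ other x) last
                         × lookup (u [ last ]≔ other x) t ≡ x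
  after t last<t = contradiction (≤fromℕ t) (<⇒≱ last<t)
sierpiński-noIsolated {_} {ℕ.zero} ()
sierpiński-noIsolated {ℕ.zero} {ℕ.suc _} _ ()
sierpiński-noIsolated {ℕ.suc ℕ.zero} {ℕ.suc _} _ (s≤s ())

{-# OPTIONS --safe #-}
module Submission where

-- Lower bound: let Z and T count the vertices labelled 0 and 2, so that the weight is p ^ n + T ∸ Z.
-- The graph splits into p ^ (n ∸ 1) cliques u ∷ʳ_; independence gives Z ≤ p ^ (n ∸ 1), and Z ≤ 2 T
-- because a vertex has at most one neighbour outside its clique.  Hence twice the weight is at least
-- 2 p ^ n ∸ p ^ (n ∸ 1).
--
-- Upper bound: match all cliques but at most one in pairs joined by an edge.  In each pair, label one
-- end of that edge 0 and the other end 2, and label 0 one more vertex of the clique of the latter;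
-- everything else gets 1, so that a pair weighs 2 p ∸ 1.  (An unmatched clique is labelled like the
-- second one of a pair, its extreme vertex getting 2.)  The matching is recursive: if p is odd, the
-- copies of two matched first letters a and d leave over the cliques a d ⋯ d and d a ⋯ a, which are
-- joined by an edge; if p is even, nothing is left over and only last letters are matched.

open import Defs
open import Data.Nat using (ℕ; _+_; _*_; _∸_; _^_; _≤_; ⌈_/2⌉; ⌊_/2⌋)

open import Algebra.Properties.Semiring.Sum as Sum using ()
open import Data.Bool.Base using (Bool; true; false; not; if_then_else_)
open import Data.Fin.Base using (Fin; zero; suc; toℕ; fromℕ<; opposite; combine; finToFun; _↑ˡ_; _↑ʳ_)
open import Data.Fin.Patterns using (0F; 1F; 2F)
open import Data.Fin.Properties 
  using (_≟_; <-cmp; any?; remQuot-combine; toℕ-injective; toℕ-fromℕ<; toℕ<n; opposite-prop; opposite-involutive)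
open import Data.Fin.Permutation using (Permutation′; permutation; reverse; transpose; _⟨$⟩ʳ_; _⟨$⟩ˡ_; inverseˡ; inverseʳ)
open import Data.Nat.Base using (zero; suc; s≤s; z≤n; _<_)
open import Data.Nat.Properties hiding (_≟_; <-cmp)
open import Data.Nat.Tactic.RingSolver using (solve-∀)
open import Data.Product.Base using (∃; _×_; _,_; proj₁; proj₂)
open import Data.Sum.Base using (_⊎_; inj₁; inj₂)
open import Data.Vec.Base using (Vec; []; _∷_; _∷ʳ_; lookup; tabulate; replicate)
open import Data.Vec.Properties using (≡-dec; ∷-injectiveˡ; ∷-injectiveʳ; lookup-replicate)
open import Function.Base using (_∘_)
open import Function.Bundles using (Inverse)
open import Level using (0ℓ)
open import Relation.Binary.Core using (Rel)
open import Relation.Binary.Definitions using (tri<; tri≈; tri>)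
open import Relation.Binary.PropositionalEquality
open import Relation.Nullary using (¬_; Dec; yes; no; does; contradiction)
open import Relation.Nullary.Decidable using (dec-true; dec-false)

open Sum +-*-semiring
  using (sum; sum-syntax; sum-cong-≗; sum-permute; ∑-distrib-+; sum-replicate-zero; *-distribˡ-sum)

private variable
  m n p : ℕ

-- Finite sums and indicators.

sum-mono : {f g : Fin n → ℕ} → (∀ i → f i ≤ g i) → sum f ≤ sum g
sum-mono {zero}  f≤g = z≤n
sum-mono {suc n} f≤g = +-mono-≤ (f≤g zero) (sum-mono (f≤g ∘ suc))

sum-const : ∀ n c → ∑[ i < n ] c ≡ n * c
sum-const zero    c = refl
sum-const (suc n) c = cong (c +_) (sum-const n c)

f≤sum-f : (f : Fin n → ℕ) (i : Fin n) → f i ≤ sum f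
f≤sum-f f zero    = m≤m+n _ _
f≤sum-f f (suc i) = ≤-trans (f≤sum-f (f ∘ suc) i) (m≤n+m _ _)

𝟙 : {P : Set} → Dec P → ℕ
𝟙 P? = if does P? then 1 else 0

𝟙-true : {P : Set} (P? : Dec P) → P → 𝟙 P? ≡ 1
𝟙-true P? holds rewrite dec-true P? holds = refl

𝟙-false : {P : Set} (P? : Dec P) → ¬ P → 𝟙 P? ≡ 0
𝟙-false P? fails rewrite dec-false P? fails = refl

sum-𝟙-≟ : (i : Fin n) → ∑[ j < n ] 𝟙 (j ≟ i) ≡ 1
sum-𝟙-≟ {suc n} zero    = cong suc (sum-replicate-zero n)
sum-𝟙-≟ {suc n} (suc i) = sum-𝟙-≟ i

-- The bound on `c` is required only when some index satisfies `P`. This suits both `c = 1`, for one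
-- zero per clique, and `c` a number of twos that the presence of a zero makes positive.
sum-𝟙-unique : {P : Fin n → Set} (P? : ∀ i → Dec (P i)) {c : ℕ} →
               (∀ i j → P i → P j → i ≡ j) → (∀ i → P i → 1 ≤ c) →
               ∑[ i < n ] 𝟙 (P? i) ≤ c
sum-𝟙-unique {n} P? {c} unique bound with any? P?
... | yes (i , Pi) = begin
  ∑[ j < n ] 𝟙 (P? j)     ≤⟨ sum-mono pointwise ⟩
  ∑[ j < n ] 𝟙 (j ≟ i)    ≡⟨ sum-𝟙-≟ i ⟩
  1                       ≤⟨ bound i Pi ⟩
  c                       ∎
  where
  open ≤-Reasoning
  pointwise : ∀ j → 𝟙 (P? j) ≤ 𝟙 (j ≟ i)
  pointwise j with P? j
  ... | no  _  = z≤n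
  ... | yes Pj = ≤-reflexive (sym (𝟙-true (j ≟ i) (unique j i Pj Pi)))
... | no ¬P = begin
  ∑[ j < n ] 𝟙 (P? j)  ≡⟨ sum-cong-≗ (λ j → 𝟙-false (P? j) (λ Pj → ¬P (j , Pj))) ⟩
  ∑[ j < n ] 0         ≡⟨ sum-replicate-zero n ⟩
  0                    ≤⟨ z≤n ⟩
  c                    ∎
  where open ≤-Reasoning

sum-↑ : ∀ m {n} (f : Fin (m + n) → ℕ) →
        sum f ≡ ∑[ i < m ] f (i ↑ˡ n) + ∑[ j < n ] f (m ↑ʳ j)
sum-↑ zero    f = refl
sum-↑ (suc m) f = trans (cong (f zero +_) (sum-↑ m (f ∘ suc))) (sym (+-assoc (f zero) _ _))

sum-combine : ∀ m {n} (f : Fin (m * n) → ℕ) →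
              sum f ≡ ∑[ i < m ] ∑[ j < n ] f (combine i j)
sum-combine zero        f = refl
sum-combine (suc m) {n} f =
  trans (sum-↑ n f) (cong (∑[ j < n ] f (j ↑ˡ (m * n)) +_) (sum-combine m (f ∘ (n ↑ʳ_))))

-- Sums over words

wordSum : (Vec (Fin p) n → ℕ) → ℕ
wordSum {n = zero}  f = f []
wordSum {n = suc _} f = sum λ a → wordSum (f ∘ (a ∷_))

wordSum-cong : {f g : Vec (Fin p) n → ℕ} → (∀ w → f w ≡ g w) → wordSum f ≡ wordSum g
wordSum-cong {n = zero}  f≗g = f≗g []
wordSum-cong {n = suc _} f≗g = sum-cong-≗ λ a → wordSum-cong (f≗g ∘ (a ∷_))

wordSum-mono : {f g : Vec (Fin p) n → ℕ} → (∀ w → f w ≤ g w) → wordSum f ≤ wordSum g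
wordSum-mono {n = zero}  f≤g = f≤g []
wordSum-mono {n = suc _} f≤g = sum-mono λ a → wordSum-mono (f≤g ∘ (a ∷_))

wordSum-+ : (f g : Vec (Fin p) n → ℕ) → wordSum (λ w → f w + g w) ≡ wordSum f + wordSum g
wordSum-+ {n = zero}  f g = refl
wordSum-+ {n = suc _} f g =
  trans (sum-cong-≗ λ a → wordSum-+ (f ∘ (a ∷_)) (g ∘ (a ∷_)))
        (∑-distrib-+ (λ a → wordSum (f ∘ (a ∷_))) (λ a → wordSum (g ∘ (a ∷_))))

wordSum-1 : ∀ p n → wordSum {p} {n} (λ _ → 1) ≡ p ^ n
wordSum-1 p zero    = refl
wordSum-1 p (suc n) = trans (sum-cong-≗ {p} λ _ → wordSum-1 p n) (sum-const p (p ^ n))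

wordSum-∷ʳ : (f : Vec (Fin p) (suc n) → ℕ) → wordSum f ≡ wordSum λ u → ∑[ d < p ] f (u ∷ʳ d)
wordSum-∷ʳ {n = zero}  f = refl
wordSum-∷ʳ {n = suc _} f = sum-cong-≗ λ a → wordSum-∷ʳ (f ∘ (a ∷_))

-- Splitting off the first letter is splitting an index by `combine`. This turns the weight, a sum
-- over indices, into a sum that recurses along words.
sum-words : (f : Vec (Fin p) n → ℕ) → sum (f ∘ Inverse.to (words p n)) ≡ wordSum f
sum-words     {n = zero}  f = +-identityʳ (f [])
sum-words {p} {n = suc n} f = trans (sum-combine p (f ∘ Inverse.to (words p (suc n)))) (sum-cong-≗ λ a →
  trans (sum-cong-≗ λ j → cong f (word-combine a j)) (sum-words (f ∘ (a ∷_))))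
  where
  word-combine : ∀ a j → Inverse.to (words p (suc n)) (combine a j) ≡ a ∷ Inverse.to (words p n) j
  word-combine a j = cong₂ _∷_ (cong proj₁ (remQuot-combine a j))
    (cong (λ x → tabulate (finToFun {p} {n} (proj₂ x))) (remQuot-combine a j))

-- Conjugation with the enumeration makes `σ` a permutation of indices.
wordSum-involution : (σ : Vec (Fin p) n → Vec (Fin p) n) → (∀ w → σ (σ w) ≡ w) →
                     (f : Vec (Fin p) n → ℕ) → wordSum (f ∘ σ) ≡ wordSum f
wordSum-involution {p} {n} σ σ∘σ f = sym (begin
  wordSum f                 ≡⟨ sum-words f ⟨
  sum (f ∘ to)              ≡⟨ sum-permute (f ∘ to) (permutation π π π∘π π∘π) ⟩
  sum (f ∘ to ∘ π)          ≡⟨ sum-cong-≗ (λ i → cong f (strictlyInverseˡ (σ (to i)))) ⟩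
  sum (f ∘ σ ∘ to)          ≡⟨ sum-words (f ∘ σ) ⟩
  wordSum (f ∘ σ)           ∎)
  where
  open ≡-Reasoning
  open Inverse (words p n)
  π : Fin (p ^ n) → Fin (p ^ n)
  π = from ∘ σ ∘ to
  π∘π : ∀ i → π (π i) ≡ i
  π∘π i = trans (cong (from ∘ σ) (strictlyInverseˡ (σ (to i))))
                (trans (cong from (σ∘σ (to i))) (strictlyInverseʳ i))

-- Adjacency of words

infix 4 _~_

-- Recursion on the common prefix replaces the index r of the definition. The constant tails are
-- given by equations, so that adjacency can be matched on for words such as `u ∷ʳ d`.
data _~_ {p : ℕ} : Rel (Vec (Fin p) n) 0ℓ where
  within : ∀ {a} {u v : Vec (Fin p) n} → u ~ v → a ∷ u ~ a ∷ v
  across : ∀ {a b} {u v : Vec (Fin p) n} → a ≢ b →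
           u ≡ replicate n b → v ≡ replicate n a → a ∷ u ~ b ∷ v

replicate-unique : {a : Fin p} (u : Vec (Fin p) n) → (∀ t → lookup u t ≡ a) → u ≡ replicate n a
replicate-unique []      _  = refl
replicate-unique (x ∷ u) eq = cong₂ _∷_ (eq zero) (replicate-unique u (eq ∘ suc))

fromAdjacent : (u v : Vec (Fin p) n) → SierpińskiAdjacent u v → u ~ v
fromAdjacent (a ∷ u) (b ∷ v) (zero , _ , a≢b , after) =
  across a≢b (replicate-unique u λ t → proj₁ (after (suc t) (s≤s z≤n)))
             (replicate-unique v λ t → proj₂ (after (suc t) (s≤s z≤n)))
fromAdjacent (a ∷ u) (b ∷ v) (suc r , before , at , after) with refl ← before zero (s≤s z≤n) =
  within (fromAdjacent u v
    (r , (λ t t<r → before (suc t) (s≤s t<r)) , at , (λ t r<t → after (suc t) (s≤s r<t))))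

toAdjacent : {u v : Vec (Fin p) n} → u ~ v → SierpińskiAdjacent u v
toAdjacent (within u~v) with r , before , at , after ← toAdjacent u~v =
  suc r , (λ { zero _ → refl ; (suc t) (s≤s t<r) → before t t<r })
        , at
        , (λ { (suc t) (s≤s r<t) → after t r<t })
toAdjacent (across a≢b refl refl) =
  zero , (λ _ ()) , a≢b , λ { (suc t) _ → lookup-replicate t _ , lookup-replicate t _ }

~-irrefl : {u : Vec (Fin p) n} → ¬ u ~ u
~-irrefl (within u~u)     = ~-irrefl u~u
~-irrefl (across a≢a _ _) = a≢a refl

clique : (u : Vec (Fin p) n) {d e : Fin p} → d ≢ e → u ∷ʳ d ~ u ∷ʳ e
clique []      d≢e = across d≢e refl refl
clique (_ ∷ u) d≢e = within (clique u d≢e)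

-- Matches the two ends of each edge joining two different cliques u ∷ʳ_, and fixes the extreme
-- vertices a ⋯ a.
cross : Vec (Fin p) (suc n) → Vec (Fin p) (suc n)
cross (a ∷ []) = a ∷ []
cross (a ∷ b ∷ w) with ≡-dec _≟_ w (replicate _ b)
... | yes _ = b ∷ replicate _ a
... | no  _ = a ∷ cross (b ∷ w)

cross-across : ∀ (a b : Fin p) → cross (a ∷ replicate (suc n) b) ≡ b ∷ replicate (suc n) a
cross-across {n = n} a b with ≡-dec _≟_ (replicate n b) (replicate n b)
... | yes _   = refl
... | no  b≢b = contradiction refl b≢b

cross-replicate : (a : Fin p) → cross (replicate (suc n) a) ≡ replicate (suc n) a
cross-replicate {n = zero}  a = refl
cross-replicate {n = suc n} a = cross-across a a

cross-within : ∀ (a : Fin p) (w : Vec (Fin p) (suc n)) → (∀ b → w ≢ replicate (suc n) b) →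
               cross (a ∷ w) ≡ a ∷ cross w
cross-within {n = n} a (b ∷ w) w≢ with ≡-dec _≟_ w (replicate _ b)
... | yes w≡ = contradiction (cong (b ∷_) w≡) (w≢ b)
... | no  _  = refl

cross-involutive : (w : Vec (Fin p) (suc n)) → cross (cross w) ≡ w
cross-involutive (a ∷ []) = refl
cross-involutive (a ∷ b ∷ w) with ≡-dec _≟_ w (replicate _ b)
... | yes refl = cross-across b a
... | no  w≢   = trans (cross-within a _ nonconstant) (cong (a ∷_) (cross-involutive (b ∷ w)))
  where
  -- `cross` fixes constant words, so a constant image would have a constant preimage.
  nonconstant : ∀ c → cross (b ∷ w) ≢ replicate _ c
  nonconstant c eq = w≢ (subst (λ x → w ≡ replicate _ x) (sym (∷-injectiveˡ bw≡c)) (∷-injectiveʳ bw≡c))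
    where
    bw≡c : b ∷ w ≡ replicate _ c
    bw≡c = trans (sym (cross-involutive (b ∷ w))) (trans (cong cross eq) (cross-replicate c))

neighbours : (u : Vec (Fin p) n) {d : Fin p} {v : Vec (Fin p) (suc n)} → u ∷ʳ d ~ v →
             (∃ λ e → v ≡ u ∷ʳ e) ⊎ v ≡ cross (u ∷ʳ d)
neighbours []      {v = e ∷ []} (across _ _ _)  = inj₁ (e , refl)
neighbours (a ∷ u) {d} (within adj) with neighbours u adj
... | inj₁ (e , refl) = inj₁ (e , refl)
-- `u ∷ʳ d` is not constant: otherwise `cross` would fix it and `adj` would be a loop.
... | inj₂ refl       = inj₂ (sym (cross-within a (u ∷ʳ d) λ b eq →
  ~-irrefl (subst (u ∷ʳ d ~_) (trans (cong cross eq) (trans (cross-replicate b) (sym eq))) adj)))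
neighbours (a ∷ u) (across {b = b} _ eq refl) =
  inj₂ (sym (trans (cong (λ w → cross (a ∷ w)) eq) (cross-across a b)))

-- By parity the slack 1 is lost: `2 * m < 2 * suc n`.
double-≤ : 2 * m ≤ 2 * n + 1 → m ≤ n
double-≤ {m} {n} 2m≤ = ≤-pred (*-cancelˡ-< 2 m (suc n)
  (subst (2 * m <_) (lemma n) (s≤s 2m≤)))
  where
  lemma : ∀ n → suc (2 * n + 1) ≡ 2 * suc n
  lemma = solve-∀

-- Lower bound: counting zeros and twos.

-- A vertex of weight 2 dominates at most one vertex of weight 0 in its own clique and at most one
-- outside, and every clique has at most one vertex of weight 0.
module _ (f : Vec (Fin p) (suc n) → Fin 3)
         (dominating  : ∀ u → f u ≡ 0F → ∃ λ v → u ~ v × f v ≡ 2F)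
         (independent : ∀ u v → f u ≡ 0F → f v ≡ 0F → ¬ u ~ v) where

  private
    zeros twos : ℕ
    zeros = wordSum λ w → 𝟙 (f w ≟ 0F)
    twos  = wordSum λ w → 𝟙 (f w ≟ 2F)

  zero-unique : ∀ u d e → f (u ∷ʳ d) ≡ 0F → f (u ∷ʳ e) ≡ 0F → d ≡ e
  zero-unique u d e fd fe with d ≟ e
  ... | yes d≡e = d≡e
  ... | no  d≢e = contradiction (clique u d≢e) (independent _ _ fd fe)

  zeros≤cliques : zeros ≤ p ^ n
  zeros≤cliques = begin
    zeros                                          ≡⟨ wordSum-∷ʳ (λ w → 𝟙 (f w ≟ 0F)) ⟩
    wordSum (λ u → ∑[ d < p ] 𝟙 (f (u ∷ʳ d) ≟ 0F)) ≤⟨ wordSum-mono (λ u → sum-𝟙-unique (λ d → f (u ∷ʳ d) ≟ 0F) (zero-unique u) (λ _ _ → ≤-refl)) ⟩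
    wordSum {p} {n} (λ _ → 1)                      ≡⟨ wordSum-1 p n ⟩
    p ^ n                                          ∎
    where open ≤-Reasoning

  -- The zero of a clique is charged to a two inside it or to a two at the far end of one of its
  -- outgoing edges. Summed over all cliques each kind counts every two once, the second because
  -- `cross` permutes the vertices.
  zeros≤2twos : zeros ≤ twos + twos
  zeros≤2twos = begin
    zeros                                          ≡⟨ wordSum-∷ʳ (λ w → 𝟙 (f w ≟ 0F)) ⟩
    wordSum (λ u → ∑[ d < p ] 𝟙 (f (u ∷ʳ d) ≟ 0F)) ≤⟨ wordSum-mono perClique ⟩
    wordSum (λ u → inside u + outside u)           ≡⟨ wordSum-+ inside outside ⟩
    wordSum inside + wordSum outside               ≡⟨ cong₂ _+_ (wordSum-∷ʳ (λ w → 𝟙 (f w ≟ 2F))) (wordSum-∷ʳ (λ w → 𝟙 (f (cross w) ≟ 2F))) ⟨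
    twos + wordSum (λ w → 𝟙 (f (cross w) ≟ 2F))    ≡⟨ cong (twos +_) (wordSum-involution cross cross-involutive (λ w → 𝟙 (f w ≟ 2F))) ⟩
    twos + twos                                    ∎
    where
    open ≤-Reasoning
    inside outside : Vec (Fin p) n → ℕ
    inside  u = ∑[ d < p ] 𝟙 (f (u ∷ʳ d) ≟ 2F)
    outside u = ∑[ d < p ] 𝟙 (f (cross (u ∷ʳ d)) ≟ 2F)

    dominated : ∀ u d → f (u ∷ʳ d) ≡ 0F → 1 ≤ inside u + outside u
    dominated u d fd with dominating (u ∷ʳ d) fd
    ... | v , adj , fv with neighbours u adj
    ...   | inj₁ (e , refl) = ≤-trans
      (≤-trans (≤-reflexive (sym (𝟙-true (f (u ∷ʳ e) ≟ 2F) fv))) (f≤sum-f _ e)) (m≤m+n _ _)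
    ...   | inj₂ refl = ≤-trans
      (≤-trans (≤-reflexive (sym (𝟙-true (f (cross (u ∷ʳ d)) ≟ 2F) fv))) (f≤sum-f _ d)) (m≤n+m _ _)

    perClique : ∀ u → ∑[ d < p ] 𝟙 (f (u ∷ʳ d) ≟ 0F) ≤ inside u + outside u
    perClique u = sum-𝟙-unique (λ d → f (u ∷ʳ d) ≟ 0F) (zero-unique u) (dominated u)

  weight-balance : wordSum (toℕ ∘ f) + zeros ≡ p ^ suc n + twos
  weight-balance = begin
    wordSum (toℕ ∘ f) + zeros                  ≡⟨ wordSum-+ (toℕ ∘ f) (λ w → 𝟙 (f w ≟ 0F)) ⟨
    wordSum (λ w → toℕ (f w) + 𝟙 (f w ≟ 0F))   ≡⟨ wordSum-cong (λ w → pointwise (f w)) ⟩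
    wordSum (λ w → 1 + 𝟙 (f w ≟ 2F))           ≡⟨ wordSum-+ (λ _ → 1) (λ w → 𝟙 (f w ≟ 2F)) ⟩
    wordSum {p} {suc n} (λ _ → 1) + twos       ≡⟨ cong (_+ twos) (wordSum-1 p (suc n)) ⟩
    p ^ suc n + twos                           ∎
    where
    open ≡-Reasoning
    pointwise : ∀ (x : Fin 3) → toℕ x + 𝟙 (x ≟ 0F) ≡ 1 + 𝟙 (x ≟ 2F)
    pointwise 0F = refl
    pointwise 1F = refl
    pointwise 2F = refl

  lowerBound : 2 * p ^ suc n ≤ 2 * wordSum (toℕ ∘ f) + p ^ n
  lowerBound = +-cancelʳ-≤ (2 * twos) _ _ (begin
    2 * p ^ suc n + 2 * twos    ≡⟨ *-distribˡ-+ 2 (p ^ suc n) twos ⟨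
    2 * (p ^ suc n + twos)      ≡⟨ cong (2 *_) weight-balance ⟨
    2 * (W + zeros)             ≡⟨ rearrange₁ W zeros ⟩
    -- One copy of `zeros` is bounded by the cliques and the other by the twos, so that `twos`
    -- cancels.
    2 * W + (zeros + zeros)     ≤⟨ +-monoʳ-≤ (2 * W) (+-mono-≤ zeros≤cliques zeros≤2twos) ⟩
    2 * W + (p ^ n + (twos + twos)) ≡⟨ rearrange₂ (2 * W) (p ^ n) twos ⟩
    2 * W + p ^ n + 2 * twos    ∎)
    where
    open ≤-Reasoning
    W : ℕ
    W = wordSum (toℕ ∘ f)
    rearrange₁ : ∀ w z → 2 * (w + z) ≡ 2 * w + (z + z)
    rearrange₁ = solve-∀
    rearrange₂ : ∀ a b c → a + (b + (c + c)) ≡ a + b + 2 * c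
    rearrange₂ = solve-∀

-- Upper bound: the labels within the cliques of one matching.

fromBool : Bool → ℕ
fromBool true  = 1
fromBool false = 0

opposite-≡ : {i j : Fin n} → j ≡ opposite i → i ≡ opposite j
opposite-≡ {i = i} refl = sym (opposite-involutive i)

-- The strict order, with ties decided by `lt`.
prefers : Bool → Fin n → Fin n → Bool
prefers lt i j with <-cmp i j
... | tri< _ _ _ = true
... | tri≈ _ _ _ = lt
... | tri> _ _ _ = false

prefers-refl : ∀ lt (i : Fin n) → prefers lt i i ≡ lt
prefers-refl lt i with <-cmp i i
... | tri< _ i≢i _ = contradiction refl i≢i
... | tri≈ _ _   _ = refl
... | tri> _ i≢i _ = contradiction refl i≢i

prefers-swap : ∀ lt {i j : Fin n} → i ≢ j → prefers lt j i ≡ not (prefers lt i j)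
prefers-swap lt {i} {j} i≢j with <-cmp i j | <-cmp j i
... | tri≈ _ i≡j _   | _              = contradiction i≡j i≢j
... | _              | tri≈ _ j≡i _   = contradiction (sym j≡i) i≢j
... | tri< i<j _ _   | tri< _ _ i≯j   = contradiction i<j i≯j
... | tri< _ _ _     | tri> _ _ _     = refl
... | tri> _ _ _     | tri< _ _ _     = refl
... | tri> _ _ i>j   | tri> j≯i _ _   = contradiction i>j j≯i

-- In the clique of a word u, letters are matched by reversing their ranks; at most one rank is
-- fixed, and its letter is the one through which u itself is matched.  `lt` tells whether u is the
-- lighter end of that pair.
module Ranks (r : ℕ) where

  private
    q : ℕ
    q = 3 + r

  middle : Fin q
  middle = fromℕ< {⌊ 2 + r /2⌋} (s≤s (⌊n/2⌋≤n (2 + r)))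

  -- Since `opposite i` is `q ∸ 1 ∸ i`, a fixed rank satisfies 2 i = q - 1. For even `q` there is
  -- none.
  fixed⇒middle : ∀ {i : Fin q} → i ≡ opposite i → i ≡ middle
  fixed⇒middle {i} fixed = toℕ-injective (begin
    toℕ i                ≡⟨ n≡⌊n+n/2⌋ (toℕ i) ⟩
    ⌊ toℕ i + toℕ i /2⌋  ≡⟨ cong ⌊_/2⌋ double ⟩
    ⌊ 2 + r /2⌋          ≡⟨ toℕ-fromℕ< (s≤s (⌊n/2⌋≤n (2 + r))) ⟨
    toℕ middle           ∎)
    where
    open ≡-Reasoning
    double : toℕ i + toℕ i ≡ 2 + r
    double = trans (cong (_+ toℕ i) (trans (cong toℕ fixed) (opposite-prop i)))
                   (m∸n+n≡m (≤-pred (toℕ<n i)))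

  -- This is the parity of `q`, in a form that lets one computation cover odd and even `q`.
  fixedRanks : ℕ
  fixedRanks = ∑[ i < q ] 𝟙 (i ≟ opposite i)

  fixedRanks≤1 : fixedRanks ≤ 1
  fixedRanks≤1 = sum-𝟙-unique (λ i → i ≟ opposite i)
    (λ i j i-fixed j-fixed → trans (fixed⇒middle i-fixed) (sym (fixed⇒middle j-fixed)))
    (λ _ _ → ≤-refl)

  light : Bool → Fin q → Bool
  light lt i = prefers lt i (opposite i)

  light-fixed : ∀ lt {i} → i ≡ opposite i → light lt i ≡ lt
  light-fixed lt {i} fixed = trans (cong (prefers lt i) (sym fixed)) (prefers-refl lt i)

  light-opposite : ∀ lt {i j} → i ≢ j → j ≡ opposite i → light lt j ≡ not (light lt i)
  light-opposite lt {i} i≢j refl =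
    trans (cong (prefers lt (opposite i)) (opposite-involutive i)) (prefers-swap lt i≢j)

  -- Add the ranks to their opposites: two distinct opposite ranks have exactly one light member,
  -- and a fixed rank contributes `lt` twice.
  sum-light : ∀ lt → 2 * ∑[ i < q ] fromBool (light lt i) + fixedRanks
                     ≡ q + 2 * (fixedRanks * fromBool lt)
  sum-light lt = begin
    2 * sum L + fixedRanks              ≡⟨ cong (λ x → sum L + x + fixedRanks) (trans (+-identityʳ (sum L)) (sum-permute L reverse)) ⟩
    sum L + sum (L ∘ opposite) + fixedRanks ≡⟨ cong (_+ fixedRanks) (∑-distrib-+ L (L ∘ opposite)) ⟨
    sum (λ i → L i + L (opposite i)) + fixedRanks ≡⟨ ∑-distrib-+ (λ i → L i + L (opposite i)) F ⟨
    sum (λ i → L i + L (opposite i) + F i)  ≡⟨ sum-cong-≗ pointwise ⟩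
    sum (λ i → 1 + c * F i)             ≡⟨ ∑-distrib-+ (λ _ → 1) (λ i → c * F i) ⟩
    ∑[ i < q ] 1 + sum (λ i → c * F i)  ≡⟨ cong₂ _+_ (sum-const q 1) (sym (*-distribˡ-sum c F)) ⟩
    q * 1 + c * fixedRanks              ≡⟨ rearrange q (fromBool lt) fixedRanks ⟩
    q + 2 * (fixedRanks * fromBool lt)  ∎
    where
    open ≡-Reasoning
    L F : Fin q → ℕ
    L i = fromBool (light lt i)
    F i = 𝟙 (i ≟ opposite i)
    c : ℕ
    c = 2 * fromBool lt
    rearrange : ∀ a b d → a * 1 + 2 * b * d ≡ a + 2 * (d * b)
    rearrange = solve-∀
    complement : ∀ b → fromBool b + fromBool (not b) + 0 ≡ 1
    complement true  = refl
    complement false = refl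
    doubled : ∀ b → fromBool b + fromBool b + 1 ≡ 1 + 2 * fromBool b * 1
    doubled true  = refl
    doubled false = refl
    pointwise : ∀ i → L i + L (opposite i) + F i ≡ 1 + c * F i
    pointwise i with i ≟ opposite i
    ... | no  i≢ rewrite light-opposite lt i≢ refl =
      trans (complement (light lt i)) (sym (cong suc (*-zeroʳ c)))
    ... | yes i≡ = trans
      (cong₂ (λ x y → fromBool x + fromBool y + 1) (light-fixed lt i≡)
             (trans (cong (light lt) (sym i≡)) (light-fixed lt i≡)))
      (doubled lt)

  Small : Fin q → Set
  Small i = i ≡ 0F ⊎ i ≡ 1F

  -- As `q` is at least 3, ranks 0 and 1 do not exceed their opposites, so they can be heavy only by
  -- a tie.
  small-heavy⇒fixed : ∀ lt {i} → Small i → light lt i ≡ false → i ≡ opposite i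
  small-heavy⇒fixed lt {i} small heavy with <-cmp i (opposite i)
  small-heavy⇒fixed lt (inj₁ refl) heavy | tri> _ _ ()
  small-heavy⇒fixed lt (inj₂ refl) heavy | tri> _ _ (s≤s ())
  ... | tri≈ _ fixed _ = fixed

  -- The rank labelled 0 in a heavy clique. Keeping it at 0 or 1 makes its cross edge lead to a
  -- light clique or to one of fixed rank.
  spare : Fin q → Fin q
  spare i with opposite i ≟ 0F
  ... | yes _ = 1F
  ... | no  _ = 0F

  spare-small : ∀ i → Small (spare i)
  spare-small i with opposite i ≟ 0F
  ... | yes _ = inj₂ refl
  ... | no  _ = inj₁ refl

  spare≢opposite : ∀ i → spare i ≢ opposite i
  spare≢opposite i eq with opposite i ≟ 0F
  ... | yes o≡0 = contradiction (trans eq o≡0) λ ()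
  ... | no  o≢0 = o≢0 (sym eq)

  zeroRank : Bool → Fin q → Fin q
  zeroRank lt i = if light lt i then opposite i else spare i

  zeroRank-light : ∀ lt {i} → light lt i ≡ true → zeroRank lt i ≡ opposite i
  zeroRank-light lt {i} = cong (if_then opposite i else spare i)

  zeroRank-heavy : ∀ lt {i} → light lt i ≡ false → zeroRank lt i ≡ spare i
  zeroRank-heavy lt {i} = cong (if_then opposite i else spare i)

  -- The label of the vertex u ∷ʳ a ∷ʳ d, where i and j are the ranks of a and d in the clique of u.
  value : Bool → Fin q → Fin q → Fin 3
  value lt i j with j ≟ zeroRank lt i | j ≟ opposite i
  ... | yes _ | _     = 0F
  ... | no  _ | yes _ = 2F
  ... | no  _ | no  _ = 1F

  value≡0⇒zeroRank : ∀ lt i {j} → value lt i j ≡ 0F → j ≡ zeroRank lt i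
  value≡0⇒zeroRank lt i {j} eq with j ≟ zeroRank lt i | j ≟ opposite i
  ... | yes j≡ | _     = j≡
  value≡0⇒zeroRank lt i () | no _ | yes _
  value≡0⇒zeroRank lt i () | no _ | no  _

  value-0 : ∀ lt i {j} → j ≡ zeroRank lt i → value lt i j ≡ 0F
  value-0 lt i {j} j≡ with j ≟ zeroRank lt i
  ... | yes _  = refl
  ... | no  j≢ = contradiction j≡ j≢

  value-2 : ∀ lt i {j} → light lt i ≡ false → j ≡ opposite i → value lt i j ≡ 2F
  value-2 lt i {j} heavy j≡o with j ≟ zeroRank lt i | j ≟ opposite i
  ... | yes j≡z | _      = contradiction (trans (sym (trans j≡z (zeroRank-heavy lt heavy))) j≡o)
                                         (spare≢opposite i)
  ... | no  _   | yes _  = refl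
  ... | no  _   | no j≢o = contradiction j≡o j≢o

  value-1 : ∀ lt i {j} → j ≢ zeroRank lt i → j ≢ opposite i → value lt i j ≡ 1F
  value-1 lt i {j} j≢z j≢o with j ≟ zeroRank lt i | j ≟ opposite i
  ... | yes j≡ | _      = contradiction j≡ j≢z
  ... | no  _  | yes j≡ = contradiction j≡ j≢o
  ... | no  _  | no  _  = refl

  -- The labels belong to the two ends of a cross edge. Two light cliques with facing zeros would be
  -- opposite, so one would be heavy. A light clique has its zero facing the two, not the spare
  -- zero, of a heavy one. Two heavy cliques would both have small rank, hence the fixed one.
  value-independent : ∀ lt i j → value lt i j ≡ 0F → value lt j i ≡ 0F → i ≡ j
  value-independent lt i j vᵢⱼ vⱼᵢ = cases (light lt i) (light lt j) refl refl
    where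
    j≡ : j ≡ zeroRank lt i
    j≡ = value≡0⇒zeroRank lt i vᵢⱼ
    i≡ : i ≡ zeroRank lt j
    i≡ = value≡0⇒zeroRank lt j vⱼᵢ

    cases : ∀ x y → light lt i ≡ x → light lt j ≡ y → i ≡ j
    cases true true lᵢ lⱼ with i ≟ j
    ... | yes i≡j = i≡j
    ... | no  i≢j = contradiction (trans (sym lⱼ)
      (trans (light-opposite lt i≢j (trans j≡ (zeroRank-light lt lᵢ))) (cong not lᵢ))) λ ()
    cases true false lᵢ lⱼ = contradiction
      (trans (sym (trans i≡ (zeroRank-heavy lt lⱼ))) (opposite-≡ (trans j≡ (zeroRank-light lt lᵢ))))
      (spare≢opposite j)
    cases false true lᵢ lⱼ = contradiction
      (trans (sym (trans j≡ (zeroRank-heavy lt lᵢ))) (opposite-≡ (trans i≡ (zeroRank-light lt lⱼ))))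
      (spare≢opposite i)
    cases false false lᵢ lⱼ = trans
      (fixed⇒middle (small-heavy⇒fixed lt
        (subst Small (sym (trans i≡ (zeroRank-heavy lt lⱼ))) (spare-small j)) lᵢ))
      (sym (fixed⇒middle (small-heavy⇒fixed lt
        (subst Small (sym (trans j≡ (zeroRank-heavy lt lᵢ))) (spare-small i)) lⱼ)))

  value-fixed : ∀ lt {i} → i ≡ opposite i → value lt i i ≡ (if lt then 0F else 2F)
  value-fixed true  {i} fixed = value-0 true i
    (trans fixed (sym (zeroRank-light true (light-fixed true fixed))))
  value-fixed false {i} fixed = value-2 false i (light-fixed false fixed) fixed

  -- In a heavy clique the zero has small rank, and an unfixed heavy rank is not small.
  value-unfixed : ∀ lt {i} → i ≢ opposite i → value lt i i ≡ 1F
  value-unfixed lt {i} unfixed = value-1 lt i (cases (light lt i) refl) unfixed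
    where
    cases : ∀ x → light lt i ≡ x → i ≢ zeroRank lt i
    cases true  l i≡ = unfixed (trans i≡ (zeroRank-light lt l))
    cases false l i≡ = unfixed (small-heavy⇒fixed lt
      (subst Small (sym (trans i≡ (zeroRank-heavy lt l))) (spare-small i)) l)

  -- A light clique has one 0 and no 2; a heavy clique has one of each.
  sum-value : ∀ lt i → ∑[ j < q ] toℕ (value lt i j) + fromBool (light lt i) ≡ q
  sum-value lt i = +-cancelʳ-≡ 1 _ _ (begin
    sum V + b + 1                                ≡⟨ rearrange (sum V) b ⟩
    sum V + 1 + b * 1                            ≡⟨ cong₂ (λ x y → sum V + x + b * y) (sum-𝟙-≟ (zeroRank lt i)) (sum-𝟙-≟ (opposite i)) ⟨
    sum V + sum Z + b * sum O                    ≡⟨ cong₂ _+_ (sym (∑-distrib-+ V Z)) (*-distribˡ-sum b O) ⟩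
    sum (λ j → V j + Z j) + sum (λ j → b * O j)  ≡⟨ ∑-distrib-+ (λ j → V j + Z j) (λ j → b * O j) ⟨
    sum (λ j → V j + Z j + b * O j)              ≡⟨ sum-cong-≗ pointwise ⟩
    sum (λ j → 1 + O j)                          ≡⟨ ∑-distrib-+ (λ _ → 1) O ⟩
    ∑[ j < q ] 1 + sum O                         ≡⟨ cong₂ _+_ (trans (sum-const q 1) (*-identityʳ q)) (sum-𝟙-≟ (opposite i)) ⟩
    q + 1                                        ∎)
    where
    open ≡-Reasoning
    V Z O : Fin q → ℕ
    V j = toℕ (value lt i j)
    Z j = 𝟙 (j ≟ zeroRank lt i)
    O j = 𝟙 (j ≟ opposite i)
    b : ℕ
    b = fromBool (light lt i)
    rearrange : ∀ x y → x + y + 1 ≡ x + 1 + y * 1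
    rearrange = solve-∀
    pointwise : ∀ j → V j + Z j + b * O j ≡ 1 + O j
    pointwise j = cases (light lt i) refl
      where
      cases : ∀ x → light lt i ≡ x → V j + Z j + fromBool x * O j ≡ 1 + O j
      cases true l with j ≟ zeroRank lt i | j ≟ opposite i
      ... | yes _  | yes _  = refl
      ... | yes j≡ | no  j≢ = contradiction (trans j≡ (zeroRank-light lt l)) j≢
      ... | no  j≢ | yes j≡ = contradiction (trans j≡ (sym (zeroRank-light lt l))) j≢
      ... | no  _  | no  _  = refl
      cases false l with j ≟ zeroRank lt i | j ≟ opposite i
      ... | yes j≡z | yes j≡o = contradiction
        (trans (sym (trans j≡z (zeroRank-heavy lt l))) j≡o) (spare≢opposite i)
      ... | yes _   | no  _   = refl
      ... | no  _   | yes _   = refl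
      ... | no  _   | no  _   = refl

-- Upper bound: the recursive labelling and its weight.

third : ∀ {r} (x y : Fin (3 + r)) → ∃ λ z → z ≢ x × z ≢ y
third 0F            0F            = 1F , (λ ()) , λ ()
third 0F            1F            = 2F , (λ ()) , λ ()
third 0F            (suc (suc _)) = 1F , (λ ()) , λ ()
third 1F            0F            = 2F , (λ ()) , λ ()
third (suc (suc _)) 0F            = 1F , (λ ()) , λ ()
third (suc _)       (suc _)       = 0F , (λ ()) , λ ()

module Labelling (r : ℕ) where

  open Ranks r

  private
    q : ℕ
    q = 3 + r

  -- Giving `b` the middle rank makes `b` the letter left unmatched when `q` is odd.
  ranking : Fin q → Permutation′ q
  ranking b = transpose b middle

  rank : Fin q → Fin q → Fin q
  rank b a = ranking b ⟨$⟩ʳ a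

  unrank : Fin q → Fin q → Fin q
  unrank b i = ranking b ⟨$⟩ˡ i

  rank-unrank : ∀ b {i} → rank b (unrank b i) ≡ i
  rank-unrank b = inverseʳ (ranking b)

  unrank-rank : ∀ b {a} → unrank b (rank b a) ≡ a
  unrank-rank b = inverseˡ (ranking b)

  rank-injective : ∀ b {a d} → rank b a ≡ rank b d → a ≡ d
  rank-injective b eq = trans (sym (unrank-rank b)) (trans (cong (unrank b) eq) (unrank-rank b))

  rank-self : ∀ b → rank b b ≡ middle
  rank-self b rewrite dec-true (b ≟ b) refl = refl

  Fixed : Fin q → Fin q → Set
  Fixed b a = rank b a ≡ opposite (rank b a)

  fixed⇒≡ : ∀ b a → Fixed b a → a ≡ b
  fixed⇒≡ b a fixed = rank-injective b (trans (fixed⇒middle fixed) (sym (rank-self b)))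

  -- Whether the middle rank is fixed depends on `q` only, not on the letter ranked there.
  fixed-diagonal : ∀ b a c → Fixed b a → Fixed c c
  fixed-diagonal b a c fixed = subst (λ i → i ≡ opposite i)
    (trans (fixed⇒middle fixed) (sym (rank-self c))) fixed

  partner : Fin q → Fin q → Fin q
  partner b a = unrank b (opposite (rank b a))

  rank-partner : ∀ b a → rank b (partner b a) ≡ opposite (rank b a)
  rank-partner b a = rank-unrank b

  partner-involutive : ∀ b a → partner b (partner b a) ≡ a
  partner-involutive b a = trans
    (cong (unrank b) (trans (cong opposite (rank-partner b a)) (opposite-involutive (rank b a))))
    (unrank-rank b)

  partner-fixed : ∀ b a → Fixed b a → partner b a ≡ a
  partner-fixed b a fixed = trans (cong (unrank b) (sym fixed)) (unrank-rank b)

  partner-fixed⁻ : ∀ b a → partner b a ≡ a → Fixed b a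
  partner-fixed⁻ b a eq = trans (sym (cong (rank b) eq)) (rank-partner b a)

  partner-light : ∀ b lt {a} → partner b a ≢ a → light lt (rank b (partner b a)) ≡ not (light lt (rank b a))
  partner-light b lt {a} moved = light-opposite lt
    (λ eq → moved (sym (rank-injective b eq))) (rank-partner b a)

  -- The state (b , lt) reached after a prefix u consists of the letter b through which the clique of
  -- u is matched and of the orientation of that pair; the letters of fixed rank inherit lt.
  label : Fin q → Bool → Vec (Fin q) (2 + n) → Fin 3
  label {zero}  b lt (a ∷ d ∷ []) = value lt (rank b a) (rank b d)
  label {suc n} b lt (a ∷ w)      = label (partner b a) (light lt (rank b a)) w

  -- A letter of fixed rank is its own partner and inherits `lt`, so the state stays the same along
  -- the word.
  label-fixed : ∀ n {b} lt {a} → Fixed b a →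
                label b lt (replicate (2 + n) a) ≡ (if lt then 0F else 2F)
  label-fixed zero        lt     fixed = value-fixed lt fixed
  label-fixed (suc n) {b} lt {a} fixed = trans
    (cong₂ (λ c l → label c l (replicate (2 + n) a)) (partner-fixed b a fixed) (light-fixed lt fixed))
    (label-fixed n lt (fixed-diagonal b a a fixed))

  -- After `a` the matched letter is `partner b a`; were `a` fixed there, it would be its own
  -- partner.
  label-unfixed : ∀ n {b} lt {a} → ¬ Fixed b a → label b lt (replicate (2 + n) a) ≡ 1F
  label-unfixed zero        lt     unfixed = value-unfixed lt unfixed
  label-unfixed (suc n) {b} lt {a} unfixed = label-unfixed n (light lt (rank b a))
    λ fixed → unfixed (partner-fixed⁻ b a (sym (fixed⇒≡ (partner b a) a fixed)))

  label-replicate≡0 : ∀ n {b} lt {a} → label b lt (replicate (2 + n) a) ≡ 0F → Fixed b a × lt ≡ true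
  label-replicate≡0 n {b} lt {a} eq with rank b a ≟ opposite (rank b a)
  ... | no unfixed = contradiction (trans (sym eq) (label-unfixed n lt unfixed)) λ ()
  label-replicate≡0 n true  eq | yes fixed = fixed , refl
  label-replicate≡0 n false eq | yes fixed =
    contradiction (trans (sym eq) (label-fixed n false fixed)) λ ()

  label-independent : ∀ b lt (u v : Vec (Fin q) (2 + n)) →
                      label b lt u ≡ 0F → label b lt v ≡ 0F → ¬ u ~ v
  label-independent {zero} b lt (a ∷ d ∷ []) (_ ∷ e ∷ []) lu lv (within (across d≢e _ _)) =
    d≢e (rank-injective b (trans (value≡0⇒zeroRank lt (rank b a) lu)
                                 (sym (value≡0⇒zeroRank lt (rank b a) lv))))
  label-independent {zero} b lt (a ∷ d ∷ []) (e ∷ _ ∷ []) lu lv (across a≢e refl refl) =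
    a≢e (rank-injective b (value-independent lt (rank b a) (rank b e) lu lv))
  label-independent {suc n} b lt (a ∷ u) (_ ∷ v) lu lv (within u~v) =
    label-independent (partner b a) (light lt (rank b a)) u v lu lv u~v
  label-independent {suc n} b lt (a ∷ _) (e ∷ _) lu lv (across a≢e refl refl)
    with label-replicate≡0 n (light lt (rank b a)) lu | label-replicate≡0 n (light lt (rank b e)) lv
  -- Zeros at both ends of an edge between copies make the copies partners that are both light.
  ... | fixed , light-a | _ , light-e with refl ← fixed⇒≡ (partner b a) e fixed =
    contradiction (trans (sym light-e) (trans (partner-light b lt (λ eq → a≢e (sym eq))) (cong not light-a))) λ ()

  -- The exception is the extreme vertex through which a light end of a pair is matched: its two
  -- lies outside the copy, so it is dealt with one level up.
  label-dominating : ∀ b lt (u : Vec (Fin q) (2 + n)) → label b lt u ≡ 0F →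
                     (∃ λ v → u ~ v × label b lt v ≡ 2F) ⊎
                     (u ≡ replicate (2 + n) b × Fixed b b × lt ≡ true)
  label-dominating {zero} b lt (a ∷ d ∷ []) lu = cases (light lt (rank b a)) refl
    where
    d≡ : rank b d ≡ zeroRank lt (rank b a)
    d≡ = value≡0⇒zeroRank lt (rank b a) lu
    cases : ∀ x → light lt (rank b a) ≡ x →
            (∃ λ v → a ∷ d ∷ [] ~ v × label b lt v ≡ 2F) ⊎
            (a ∷ d ∷ [] ≡ replicate 2 b × Fixed b b × lt ≡ true)
    cases false heavy = inj₁ (a ∷ partner b a ∷ [] , within (across d≢ refl refl) ,
                              value-2 lt (rank b a) heavy (rank-partner b a))
      where
      d≢ : d ≢ partner b a
      d≢ eq = spare≢opposite (rank b a)
        (trans (sym (trans d≡ (zeroRank-heavy lt heavy))) (trans (cong (rank b) eq) (rank-partner b a)))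
    -- In a light clique `d` is the partner of `a`, so the two sits at the far end of the cross
    -- edge, unless `a` is its own partner.
    cases true l with a ≟ d
    ... | no a≢d = inj₁ (d ∷ a ∷ [] , across a≢d refl refl ,
      value-2 lt (rank b d)
        (trans (light-opposite lt (a≢d ∘ rank-injective b) d≡o) (cong not l))
        (opposite-≡ {i = rank b a} d≡o))
      where
      d≡o : rank b d ≡ opposite (rank b a)
      d≡o = trans d≡ (zeroRank-light lt l)
    ... | yes refl with refl ← fixed⇒≡ b a (trans d≡ (zeroRank-light lt l)) =
      inj₂ (refl , fixed , trans (sym (light-fixed lt fixed)) l)
      where
      fixed : Fixed b b
      fixed = trans d≡ (zeroRank-light lt l)
  label-dominating {suc n} b lt (a ∷ u) lu
    with label-dominating (partner b a) (light lt (rank b a)) u lu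
  ... | inj₁ (v , u~v , lv) = inj₁ (a ∷ v , within u~v , lv)
  ... | inj₂ (u≡ , fixed , l) with partner b a ≟ a
  -- The edge to the partner copy ends at the extreme vertex of a heavy copy, which is labelled 2.
  ...   | no moved = inj₁ (partner b a ∷ replicate _ a , across (moved ∘ sym) u≡ refl , two)
    where
    two : label (partner b (partner b a)) (light lt (rank b (partner b a))) (replicate (2 + n) a) ≡ 2F
    two = trans
      (cong₂ (λ c x → label c x (replicate (2 + n) a)) (partner-involutive b a)
             (trans (partner-light b lt moved) (cong not l)))
      (label-fixed n false (fixed-diagonal (partner b a) (partner b a) a fixed))
  -- The copy of `a` is itself unmatched here, so its exception becomes that of the whole word.
  ...   | yes eq = inj₂ (cong₂ _∷_ a≡b (trans u≡ (cong (replicate _) (trans eq a≡b))) ,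
                         fixed-diagonal b a b fixed-a , trans (sym (light-fixed lt fixed-a)) l)
    where
    fixed-a : Fixed b a
    fixed-a = partner-fixed⁻ b a eq
    a≡b : a ≡ b
    a≡b = fixed⇒≡ b a fixed-a

  label-total : ∀ b lt (u : Vec (Fin q) (2 + n)) → ∃ λ v → u ~ v × label b lt v ≢ 0F
  -- With three letters, a clique has a vertex other than the given one and its only zero.
  label-total {zero} b lt (a ∷ d ∷ []) with third (rank b d) (zeroRank lt (rank b a))
  ... | j , j≢d , j≢0 = a ∷ unrank b j ∷ [] ,
    within (across (λ eq → j≢d (trans (sym (rank-unrank b)) (cong (rank b) (sym eq)))) refl refl) ,
    λ eq → j≢0 (trans (sym (rank-unrank b)) (value≡0⇒zeroRank lt (rank b a) eq))
  label-total {suc n} b lt (a ∷ u) with label-total (partner b a) (light lt (rank b a)) u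
  ... | v , u~v , lv = a ∷ v , within u~v , lv

  -- x a is the weight of the copy of a, c the number of its cliques, and e is 1 if each copy leaves
  -- one clique unmatched, 0 if it leaves none.
  sum-copies : ∀ b lt c e (x : Fin q → ℕ) →
    (∀ a → 2 * x a + c + 2 * (e * fromBool (light lt (rank b a))) ≡ 2 * (q * c) + e) →
    -- Both sides are raised by `e * q`, which completes the right-hand side of `sum-light`.
    2 * sum x + q * c + 2 * (fixedRanks * e * fromBool lt) ≡ 2 * (q * (q * c)) + fixedRanks * e
  sum-copies b lt c e x copies = +-cancelʳ-≡ (e * q) _ _ (begin
    2 * sum x + q * c + 2 * (fixedRanks * e * fromBool lt) + e * q
      ≡⟨ rearrange₁ (sum x) (q * c) fixedRanks e (fromBool lt) q ⟩
    2 * sum x + q * c + e * (q + 2 * (fixedRanks * fromBool lt))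
      ≡⟨ cong (λ s → 2 * sum x + q * c + e * s) (sum-light lt) ⟨
    2 * sum x + q * c + e * (2 * sum (λ i → fromBool (light lt i)) + fixedRanks)
      ≡⟨ cong (λ s → 2 * sum x + q * c + e * (2 * s + fixedRanks))
              (sum-permute (λ i → fromBool (light lt i)) (ranking b)) ⟩
    2 * sum x + q * c + e * (2 * sum l + fixedRanks)
      ≡⟨ rearrange₂ (2 * sum x) (q * c) e (sum l) fixedRanks ⟩
    2 * sum x + q * c + 2 * e * sum l + fixedRanks * e
      ≡⟨ cong (_+ fixedRanks * e) (begin
        2 * sum x + q * c + 2 * e * sum l
          ≡⟨ cong₂ _+_ (cong₂ _+_ (*-distribˡ-sum 2 x) (sym (sum-const q c))) (*-distribˡ-sum (2 * e) l) ⟩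
        sum (λ a → 2 * x a) + ∑[ a < q ] c + sum (λ a → 2 * e * l a)
          ≡⟨ cong (_+ sum (λ a → 2 * e * l a)) (∑-distrib-+ (λ a → 2 * x a) (λ _ → c)) ⟨
        sum (λ a → 2 * x a + c) + sum (λ a → 2 * e * l a)
          ≡⟨ ∑-distrib-+ (λ a → 2 * x a + c) (λ a → 2 * e * l a) ⟨
        sum (λ a → 2 * x a + c + 2 * e * l a)
          ≡⟨ sum-cong-≗ (λ a → trans (cong (2 * x a + c +_) (*-assoc 2 e (l a))) (copies a)) ⟩
        ∑[ a < q ] (2 * (q * c) + e)
          ≡⟨ sum-const q (2 * (q * c) + e) ⟩
        q * (2 * (q * c) + e) ∎) ⟩
    q * (2 * (q * c) + e) + fixedRanks * e
      ≡⟨ rearrange₃ q (q * c) e (fixedRanks * e) ⟩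
    2 * (q * (q * c)) + fixedRanks * e + e * q ∎)
    where
    open ≡-Reasoning
    l : Fin q → ℕ
    l a = fromBool (light lt (rank b a))
    rearrange₁ : ∀ s t f e β p → 2 * s + t + 2 * (f * e * β) + e * p ≡ 2 * s + t + e * (p + 2 * (f * β))
    rearrange₁ = solve-∀
    rearrange₂ : ∀ s t e l f → s + t + e * (2 * l + f) ≡ s + t + 2 * e * l + f * e
    rearrange₂ = solve-∀
    rearrange₃ : ∀ p t e g → p * (2 * t + e) + g ≡ 2 * (p * t) + g + e * p
    rearrange₃ = solve-∀

  -- `fixedRanks ^ (1 + n)` is the number of unmatched cliques. Each matched pair saves 1 over the
  -- constant labelling 1, and an unmatched clique saves 1 only if `lt` holds.
  label-weight : ∀ n b lt →
    2 * wordSum (toℕ ∘ label {n} b lt) + q ^ (1 + n) + 2 * (fixedRanks ^ (1 + n) * fromBool lt)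
    ≡ 2 * q ^ (2 + n) + fixedRanks ^ (1 + n)
  label-weight zero b lt = sum-copies b lt 1 1 (λ a → ∑[ d < q ] toℕ (value lt (rank b a) (rank b d))) λ a →
    let x = ∑[ d < q ] toℕ (value lt (rank b a) (rank b d))
        l = fromBool (light lt (rank b a))
    in begin
      2 * x + 1 + 2 * (1 * l)  ≡⟨ rearrange x l ⟩
      2 * (x + l) + 1          ≡⟨ cong (λ s → 2 * (s + l) + 1) (sum-permute (toℕ ∘ value lt (rank b a)) (ranking b)) ⟨
      2 * (sum (toℕ ∘ value lt (rank b a)) + l) + 1  ≡⟨ cong (λ s → 2 * s + 1) (sum-value lt (rank b a)) ⟩
      2 * q + 1                ≡⟨ cong (λ s → 2 * s + 1) (*-identityʳ q) ⟨
      2 * (q * 1) + 1          ∎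
    where
    open ≡-Reasoning
    rearrange : ∀ x l → 2 * x + 1 + 2 * (1 * l) ≡ 2 * (x + l) + 1
    rearrange = solve-∀
  label-weight (suc n) b lt = sum-copies b lt (q ^ (1 + n)) (fixedRanks ^ (1 + n))
    (λ a → wordSum (toℕ ∘ label {n} (partner b a) (light lt (rank b a)))) λ a →
    label-weight n (partner b a) (light lt (rank b a))

  -- The orientation `false` gives an unmatched clique its own two and rules out the exception in
  -- `label-dominating`.
  labelling : Vec (Fin q) (2 + n) → Fin 3
  labelling = label 0F false

  upperBound : ∀ n → 2 * wordSum (toℕ ∘ labelling {n}) + q ^ (1 + n) ≤ 2 * q ^ (2 + n) + 1
  upperBound n = begin
    2 * W + q ^ (1 + n)       ≡⟨ +-identityʳ _ ⟨
    2 * W + q ^ (1 + n) + 0   ≡⟨ cong (λ x → 2 * W + q ^ (1 + n) + 2 * x) (*-zeroʳ (fixedRanks ^ (1 + n))) ⟨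
    2 * W + q ^ (1 + n) + 2 * (fixedRanks ^ (1 + n) * 0)  ≡⟨ label-weight n 0F false ⟩
    2 * q ^ (2 + n) + fixedRanks ^ (1 + n)  ≤⟨ +-monoʳ-≤ (2 * q ^ (2 + n)) (^-monoˡ-≤ (1 + n) fixedRanks≤1) ⟩
    2 * q ^ (2 + n) + 1 ^ (1 + n)           ≡⟨ cong (2 * q ^ (2 + n) +_) (^-zeroˡ (1 + n)) ⟩
    2 * q ^ (2 + n) + 1       ∎
    where
    open ≤-Reasoning
    W : ℕ
    W = wordSum (toℕ ∘ labelling {n})

  labelling-isOITRD : (noIsolated : NoIsolatedVertex (FiniteGraph.Adjacent (Sierpiński q (2 + n)))) →
                      OITRD.IsOITRDFunction (Sierpiński q (2 + n)) noIsolated labelling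
  labelling-isOITRD _ = record
    { dominating  = dominating
    ; independent = λ u v lu lv adj → label-independent 0F false u v lu lv (fromAdjacent u v adj)
    ; total       = total
    }
    where
    dominating : ∀ u → labelling u ≡ 0F → ∃ λ v → SierpińskiAdjacent u v × labelling v ≡ 2F
    dominating u lu with label-dominating 0F false u lu
    ... | inj₁ (v , u~v , lv) = v , toAdjacent u~v , lv
    ... | inj₂ (_ , _ , ())

    positive : ∀ {x : Fin 3} → x ≢ 0F → x ≡ 1F ⊎ x ≡ 2F
    positive {0F} x≢0 = contradiction refl x≢0
    positive {1F} _   = inj₁ refl
    positive {2F} _   = inj₂ refl

    total : NoIsolatedVertex (Induced SierpińskiAdjacent (λ v → labelling v ≡ 1F ⊎ labelling v ≡ 2F))
    total (u , _) with label-total 0F false u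
    ... | v , u~v , lv = (v , positive lv) , toAdjacent u~v

-- Rounding the two bounds to the stated value.

module _ (p q : ℕ) where

  private
    k h : ℕ
    k = p * ⌈ q /2⌉ + (p ∸ 1) * ⌊ q /2⌋
    h = ⌊ q /2⌋

  -- With `q` the number of cliques, `k` is the number of vertices less one for each pair of
  -- cliques.
  half-complement : 1 ≤ p → k + h ≡ p * q
  half-complement (s≤s {n = p′} _) = begin
    p * ⌈ q /2⌉ + p′ * h + h  ≡⟨ rearrange ⌈ q /2⌉ p′ h ⟩
    p * (h + ⌈ q /2⌉)         ≡⟨ cong (p *_) (⌊n/2⌋+⌈n/2⌉≡n q) ⟩
    p * q                     ∎
    where
    open ≡-Reasoning
    rearrange : ∀ c p h → suc p * c + p * h + h ≡ suc p * (h + c)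
    rearrange = solve-∀

  2h≤q : 2 * h ≤ q
  2h≤q = begin
    2 * h          ≡⟨ cong (h +_) (+-identityʳ h) ⟩
    h + h          ≤⟨ +-monoʳ-≤ h (⌊n/2⌋≤⌈n/2⌉ q) ⟩
    h + ⌈ q /2⌉    ≡⟨ ⌊n/2⌋+⌈n/2⌉≡n q ⟩
    q              ∎
    where open ≤-Reasoning

  q≤2h+1 : q ≤ 2 * h + 1
  q≤2h+1 = begin
    q              ≡⟨ ⌊n/2⌋+⌈n/2⌉≡n q ⟨
    h + ⌈ q /2⌉    ≤⟨ +-monoʳ-≤ h (⌈n/2⌉≤1+⌊n/2⌋ q) ⟩
    h + suc h      ≡⟨ rearrange h ⟩
    2 * h + 1      ∎
    where
    open ≤-Reasoning
    ⌈n/2⌉≤1+⌊n/2⌋ : ∀ n → ⌈ n /2⌉ ≤ suc ⌊ n /2⌋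
    ⌈n/2⌉≤1+⌊n/2⌋ n = ⌊n/2⌋-mono (n≤1+n (suc n))
    rearrange : ∀ h → h + suc h ≡ 2 * h + 1
    rearrange = solve-∀

  -- `2 * h` falls short of `q` by at most 1, and `double-≤` absorbs this.
  half-≤ : ∀ {w} → 1 ≤ p → 2 * (p * q) ≤ 2 * w + q → k ≤ w
  half-≤ {w} 1≤p bound = double-≤ (+-cancelʳ-≤ (2 * h) _ _ (begin
    2 * k + 2 * h        ≡⟨ *-distribˡ-+ 2 k h ⟨
    2 * (k + h)          ≡⟨ cong (2 *_) (half-complement 1≤p) ⟩
    2 * (p * q)          ≤⟨ bound ⟩
    2 * w + q            ≤⟨ +-monoʳ-≤ (2 * w) q≤2h+1 ⟩
    2 * w + (2 * h + 1)  ≡⟨ rearrange (2 * w) (2 * h) ⟩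
    2 * w + 1 + 2 * h    ∎))
    where
    open ≤-Reasoning
    rearrange : ∀ a b → a + (b + 1) ≡ a + 1 + b
    rearrange = solve-∀

  half-≥ : ∀ {w} → 1 ≤ p → 2 * w + q ≤ 2 * (p * q) + 1 → w ≤ k
  half-≥ {w} 1≤p bound = double-≤ (+-cancelʳ-≤ (2 * h) _ _ (begin
    2 * w + 2 * h        ≤⟨ +-monoʳ-≤ (2 * w) 2h≤q ⟩
    2 * w + q            ≤⟨ bound ⟩
    2 * (p * q) + 1      ≡⟨ cong (λ x → 2 * x + 1) (half-complement 1≤p) ⟨
    2 * (k + h) + 1      ≡⟨ rearrange k h ⟩
    2 * k + 1 + 2 * h    ∎))
    where
    open ≤-Reasoning
    rearrange : ∀ a b → 2 * (a + b) + 1 ≡ 2 * a + 1 + 2 * b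
    rearrange = solve-∀

theorem3p1 : ∀ (n p : ℕ) (2≤n : 2 ≤ n) (3≤p : 3 ≤ p) →
    IsOITRDNumber (Sierpiński p n) (sierpiński-noIsolated 2≤n 3≤p)
    (p * ⌈ p ^ (n ∸ 1) /2⌉ + (p ∸ 1) * ⌊ p ^ (n ∸ 1) /2⌋)
theorem3p1 (suc (suc n)) (suc (suc (suc r))) 2≤n@(s≤s (s≤s z≤n)) 3≤p@(s≤s (s≤s (s≤s z≤n))) = record
  { attained = labelling , isOITRD , ≤-antisym weight≤ (minimal labelling isOITRD)
  ; minimal  = minimal
  }
  where
  open Labelling r
  open OITRD (Sierpiński (3 + r) (2 + n)) (sierpiński-noIsolated 2≤n 3≤p)
    using (IsOITRDFunction; weight)

  isOITRD : IsOITRDFunction labelling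
  isOITRD = labelling-isOITRD (sierpiński-noIsolated 2≤n 3≤p)

  k : ℕ
  k = (3 + r) * ⌈ (3 + r) ^ suc n /2⌉ + (2 + r) * ⌊ (3 + r) ^ suc n /2⌋

  minimal : ∀ f → IsOITRDFunction f → k ≤ weight f
  minimal f f-OITRD = subst (k ≤_) (sym (sum-words (toℕ ∘ f)))
    (half-≤ (3 + r) ((3 + r) ^ suc n) (s≤s z≤n) (lowerBound f
      (λ u fu → let v , adj , fv = dominating u fu in v , fromAdjacent u v adj , fv)
      (λ u v fu fv u~v → independent u v fu fv (toAdjacent u~v))))
    where open IsOITRDFunction f-OITRD

  weight≤ : weight labelling ≤ k
  weight≤ = subst (_≤ k) (sym (sum-words (toℕ ∘ labelling {n})))
    (half-≥ (3 + r) ((3 + r) ^ suc n) (s≤s z≤n) (upperBound n))
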